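{- Let $C_r$ ($r\ge 3$) be the directed cycle of length $r$. Then (a) $\chi^*_o(C_r)=3$ if $r\equiv 0 \pmod 3$; (b) $\chi^*_o(C_4)=4$; (c) $\chi^*_o(C_5)=5$; (d) $\chi^*_o(C_r)=4-\beta(r)$ if $r>5$ and $r\not\equiv 0\pmod 3$.
   Context: The directed cycle $C_r$ has vertices $u_i$, $i\in\mathbb{Z}/r\mathbb{Z}$, and arcs $u_iu_{i+1}$ (indices mod $r$). For a set $S$ of $k$ colors, a $b$-fold oriented $k$-coloring of an oriented graph $G$ is a map $f$ from $V(G)$ to the $b$-element subsets of $S$ such that (i) $f(x)\cap f(y)=\emptyset$ for every arc $xy$, and (ii) for all arcs $xy, zw$, $f(x)\cap f(w)\neq\emptyset$ implies $f(y)\cap f(z)=\emptyset$. $\chi^b_o(G)$ is the minimum such $k$, and $\chi^*_o(G)=\lim_{b\to\infty}\chi^b_o(G)/b=\inf_{b\ge1}\chi^b_o(G)/b$. A prime $p>3$ is type-A if $p\equiv 3 \pmod 4$. For an integer $r>5$: $\beta(r)=0$ if $r$ has no type-A prime factor, and otherwise $\beta(r)=\frac{4}{p+1}$ where $p$ is the least type-A prime factor of $r$. -}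

module Defs where

open import Data.Fin.Base using (Fin; toℕ)
open import Data.Fin.Properties using (toℕ<n)
open import Data.Fin.Subset using (Subset; Nonempty; Empty; _∩_) renaming (∣_∣ to card)
open import Data.Integer.Base using (+_)
open import Data.List.Base using (filter; head; upTo)
open import Data.Maybe.Base using (Maybe; maybe′)
open import Data.Nat.Base using (ℕ; suc; _≤_; _<_; s≤s; z≤n; NonZero; >-nonZero)
open import Data.Nat.DivMod using (_%_; m<n⇒m%n≡m; n%n≡0)
open import Data.Nat.Divisibility using (_∣_; _∣?_)
open import Data.Nat.Primality using (Prime; prime?)
open import Data.Nat.Properties using (_≟_; _<?_; m≤n⇒m<n∨m≡n; ≤-trans; <-irrefl; m≤n+m)
open import Data.Product.Base using (Σ; _×_; _,_)
open import Data.Rational.Base as ℚ using (ℚ; 0ℚ; _/_)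
open import Data.Sum.Base using (_⊎_; inj₁; inj₂)
open import Level using (0ℓ)
open import Relation.Binary.Core using (Rel)
open import Relation.Binary.Definitions using (Asymmetric)
open import Relation.Binary.PropositionalEquality using (_≡_; refl; trans)
open import Relation.Nullary.Decidable using (_×-dec_)
open import Relation.Unary using (Decidable)
open import Data.Empty using (⊥)

-- Asymmetry also excludes loops.
record OrientedGraph : Set₁ where
  field
    Vertex : Set
    Arc    : Rel Vertex 0ℓ
    asym   : Asymmetric Arc

module _ (G : OrientedGraph) where
  open OrientedGraph G

  record IsOrientedColoring (b k : ℕ) (f : Vertex → Subset k) : Set where
    field
      size     : ∀ x → card (f x) ≡ b
      proper   : ∀ {x y} → Arc x y → Empty (f x ∩ f y)
      oriented : ∀ {x y z w} → Arc x y → Arc z w →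
                 Nonempty (f x ∩ f w) → Empty (f y ∩ f z)

  OrientedColorable : ℕ → ℕ → Set
  OrientedColorable b k = Σ (Vertex → Subset k) (IsOrientedColoring b k)

  record IsOrientedChromaticNumber (b k : ℕ) : Set where
    field
      colorable : OrientedColorable b k
      minimal   : ∀ k′ → OrientedColorable b k′ → k ≤ k′

-- Sequences of rationals are indexed by the positive integers.
PosSequence : Set
PosSequence = (b : ℕ) → .{{NonZero b}} → ℚ

record IsInfimum (a : PosSequence) (q : ℚ) : Set where
  field
    lowerBound : ∀ b .{{_ : NonZero b}} → q ℚ.≤ a b
    greatest   : ∀ ℓ → (∀ b .{{_ : NonZero b}} → ℓ ℚ.≤ a b) → ℓ ℚ.≤ q

IsLimit : PosSequence → ℚ → Set
IsLimit a q = ∀ ε → 0ℚ ℚ.< ε →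
  Σ ℕ λ N → ∀ b .{{_ : NonZero b}} → N ≤ b → ℚ.∣ a b ℚ.- q ∣ ℚ.< ε

-- χ*ₒ(G) = q, for rational q: the minima χᵇₒ(G) exist for all b ≥ 1, and q is
-- both the limit and the infimum of χᵇₒ(G) / b.
record IsFractionalOrientedChromaticNumber (G : OrientedGraph) (q : ℚ) : Set where
  field
    χ          : ℕ → ℕ
    χ-isNumber : ∀ b .{{_ : NonZero b}} → IsOrientedChromaticNumber G b (χ b)
    isLimit    : IsLimit   (λ b → + χ b / b) q
    isInfimum  : IsInfimum (λ b → + χ b / b) q

CycleArc : (r : ℕ) .{{_ : NonZero r}} → Rel (Fin r) 0ℓ
CycleArc r i j = toℕ j ≡ suc (toℕ i) % r

private
  suc-mod : ∀ r .{{_ : NonZero r}} i → i < r →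
            suc i % r ≡ suc i ⊎ (suc i ≡ r × suc i % r ≡ 0)
  suc-mod r i i<r with m≤n⇒m<n∨m≡n i<r
  ... | inj₁ 1+i<r = inj₁ (m<n⇒m%n≡m 1+i<r)
  ... | inj₂ refl  = inj₂ (refl , n%n≡0 (suc i))

  no-2-cycle : ∀ r .{{_ : NonZero r}} → 3 ≤ r → ∀ i j → i < r → j < r →
               j ≡ suc i % r → i ≡ suc j % r → ⊥
  no-2-cycle r 3≤r i j i<r j<r p q with suc-mod r i i<r | suc-mod r j j<r
  ... | inj₁ a       | inj₁ c with trans p a | trans q c
  ...   | refl | e = <-irrefl e (m≤n+m (suc i) 1)
  no-2-cycle r 3≤r i j i<r j<r p q | inj₁ a | inj₂ (e , c) with trans p a | trans q c | e
  ...   | refl | refl | refl with 3≤r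
  ...     | s≤s (s≤s ())
  no-2-cycle r 3≤r i j i<r j<r p q | inj₂ (e , a) | inj₁ c with trans p a | trans q c | e
  ...   | refl | refl | refl with 3≤r
  ...     | s≤s (s≤s ())
  no-2-cycle r 3≤r i j i<r j<r p q | inj₂ (e , a) | inj₂ (e′ , c) with trans p a | trans q c | e
  ...   | refl | refl | refl with 3≤r
  ...     | s≤s ()

directedCycle : (r : ℕ) → 3 ≤ r → OrientedGraph
directedCycle r 3≤r = record
  { Vertex = Fin r
  ; Arc    = CycleArc r
  ; asym   = λ {i} {j} → no-2-cycle r 3≤r (toℕ i) (toℕ j) (toℕ<n i) (toℕ<n j)
  }
  where
  instance
    r≢0 : NonZero r
    r≢0 = >-nonZero (≤-trans (s≤s z≤n) 3≤r)

TypeA : ℕ → Set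
TypeA p = Prime p × 3 < p × p % 4 ≡ 3

typeA? : Decidable TypeA
typeA? p = prime? p ×-dec 3 <? p ×-dec p % 4 ≟ 3

-- The list searched is increasing, so its head is the least factor; the bound
-- loses nothing for r ≥ 1.
leastTypeAFactor : ℕ → Maybe ℕ
leastTypeAFactor r = head (filter (λ p → typeA? p ×-dec p ∣? r) (upTo (suc r)))

β : ℕ → ℚ
β r = maybe′ (λ p → + 4 / suc p) 0ℚ (leastTypeAFactor r)

{-# OPTIONS --safe #-}
-- Lower bound.  Write A i for the color set of the i-th vertex (i read modulo r) and i ~ j when
-- A i and A j meet.  The coloring axioms say exactly that i ~ j + 1 excludes i + 1 ~ j.  If k < 4b,
-- then no four color sets are pairwise disjoint.  These two facts make ~ invariant under
-- translation, so it is given by a set N of distances, whose members form runs of length one or two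
-- separated by gaps of exactly two; both 0 and r are runs of length one.  If a distance n is such a
-- run, then for any a the points a, a+1, a+2 stay pairwise disjoint after adding n to any of them,
-- so every x meets both a+f and a+f+n for some f ≤ 2.  It follows that subtracting n from a larger
-- run of length one gives another, so the least positive one, n, divides r.  All runs in
-- between having length two, n = 4T + 3 and N consists of the distances 0, 3 mod 4 below n.
-- A color thus occurs at most T + 1 times on n consecutive vertices, whence n b ≤ (T + 1) k.
-- If 3 does not divide r, n has a prime factor p ≡ 3 mod 4 other than 3, and
-- k / b ≥ 4 - 4 / (n + 1) ≥ 4 - 4 / (p + 1).
--
-- Upper bound.  For p = 4T + 3 dividing r, color vertex x by the T + 1 residues (T + 1) x + j mod p,
-- 0 ≤ j ≤ T, in the rotational tournament s → s + e, 1 ≤ e ≤ 2T + 1.  For r > 5, C_r maps to a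
-- tournament on four vertices with cycles of lengths 3 and 4.
module Submission where

open import Defs
open import Algebra.Properties.CommutativeSemigroup using (interchange)
open import Data.Bool.Base using (Bool; true; false)
open import Data.Empty using (⊥; ⊥-elim)
open import Data.Fin.Base using (Fin; zero; suc; toℕ; fromℕ<; inject≤; combine; remQuot; quotient)
open import Data.Fin.Properties as Fin using (toℕ-fromℕ<; fromℕ<-cong; toℕ<n; toℕ-injective; all?;
  inject≤-injective; remQuot-combine; combine-remQuot)
open import Data.Fin.Subset using (Subset; inside; Nonempty; Empty; _∩_; _∈_; _∉_) renaming (∣_∣
  to card; ⊥ to ∅)
open import Data.Fin.Subset.Properties using (nonempty?; ∩-comm; ∩-idem; x∈p∩q⁺; x∈p∩q⁻; ∣⊥∣≡0;
  ∉⊥; anySubset?)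
open import Data.Integer.Base as ℤ using (+_; +<+)
import Data.Integer.Properties as ℤ
open import Data.List.Base using (List; []; _∷_; map; length; head; filter; applyUpTo;
  applyDownFrom)
open import Data.List.Properties using (length-applyDownFrom; length-map)
open import Data.List.Relation.Unary.All as All using (All; []; _∷_)
import Data.List.Relation.Unary.All.Properties as All
open import Data.List.Relation.Unary.AllPairs as AllPairs using (AllPairs; []; _∷_)
import Data.List.Relation.Unary.AllPairs.Properties as AllPairs
open import Data.Maybe.Base using (Maybe; just; nothing; maybe′)
open import Data.Maybe.Properties using (just-injective)
open import Data.Nat.Base using (ℕ; zero; suc; _+_; _*_; _∸_; _≤_; _<_; z≤n; s≤s; NonZero;
  >-nonZero)
open import Data.Nat.DivMod using (_%_; m≡m%n+[m/n]*n; m/n*n≤m; m%n<n; m%n≤m; m%n%n≡m%n;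
  m<n⇒m%n≡m; n%n≡0; m<n*o⇒m/o<n; [m+n]%n≡m%n; [m+kn]%n≡m%n; %-distribˡ-+; %-distribˡ-*;
  m∣n⇒o%n%m≡o%m) renaming (_/_ to _div_)
open import Data.Nat.Divisibility using (_∣_; _∣?_; divides; ∣-refl; ∣-trans; ∣⇒≤; >⇒∤; ∣m∣n⇒∣m+n;
  ∣m+n∣m⇒∣n; n∣m*n; m∣m*n; ∣n⇒∣m*n; m%n≡0⇒n∣m; n∣m⇒m%n≡0)
open import Data.Nat.ListAction using (sum; product)
open import Data.Nat.Primality using (Prime)
open import Data.Nat.Primality.Factorisation using (factorise; module PrimeFactorisation)
open import Data.Nat.Properties
open import Data.Nat.Tactic.RingSolver using (solve-∀)
open import Data.Product.Base using (Σ; _×_; _,_; proj₁; proj₂)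
open import Data.Product.Properties using (,-injectiveˡ; ,-injectiveʳ)
open import Data.Rational.Base as ℚ using (0ℚ; _/_; _-_; toℚᵘ)
import Data.Rational.Properties as ℚ
open import Data.Rational.Unnormalised.Base as ℚᵘ using (mkℚᵘ)
import Data.Rational.Unnormalised.Properties as ℚᵘ
open import Data.Sum.Base using (_⊎_; inj₁; inj₂)
open import Data.Vec.Base using ([]; _∷_; here; there; lookup; tail; _[_]≔_)
import Data.Vec.Functional as Vector
open import Data.Vec.Properties using (lookup⇒[]=; []=⇒lookup)
open import Level using (0ℓ)
open import Relation.Binary.Core using (Rel)
import Relation.Binary.Definitions as Binary
open import Relation.Binary.Definitions using (Asymmetric)
open import Relation.Binary.PropositionalEquality using (_≡_; _≢_; refl; sym; trans; cong; cong₂;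
  subst; subst₂; _≗_; module ≡-Reasoning)
open import Relation.Nullary using (¬_; Dec; yes; no; contradiction; ¬?)
open import Relation.Nullary.Decidable using (map′; _×-dec_; _→-dec_)
open import Relation.Unary using (Decidable)

-- The set of distances at which color sets meet.

-- i ~ j stands for "the color sets of vertices i and j of the cycle meet".
module CyclicPattern
  (_~_ : Rel ℕ 0ℓ) (_~?_ : Binary.Decidable _~_)
  (~-refl : ∀ i → i ~ i)
  (~-sym : ∀ {i j} → i ~ j → j ~ i)
  (c : ℕ)
  (unwrap : ∀ {i j} → i ~ (3 + c + j) → i ~ j)
  (wrap : ∀ {i j} → i ~ j → i ~ (3 + c + j))
  (cross : ∀ {i j} → i ~ suc j → ¬ (suc i ~ j))
  (no-independent-4 : ∀ {w x y z} → ¬ (w ~ x) → ¬ (w ~ y) → ¬ (w ~ z) →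
                      ¬ (x ~ y) → ¬ (x ~ z) → ¬ (y ~ z) → ⊥)
  where

  r : ℕ
  r = 3 + c

  N E : ℕ → Set
  N d = ∀ i → i ~ (d + i)
  E d = ∀ i → ¬ (i ~ (d + i))

  ¬NE : ∀ {d} → N d → E d → ⊥
  ¬NE n e = e 0 (n 0)

  E-at : ∀ {d i j} → E d → d + i ≡ j → ¬ (i ~ j)
  E-at e refl = e _

  E-at′ : ∀ {d i j} → E d → d + i ≡ j → ¬ (j ~ i)
  E-at′ e eq p = E-at e eq (~-sym p)

  E1 : E 1
  E1 i p = cross p (~-sym p)

  E2 : E 2
  E2 i p = cross p (~-refl (suc i))

  N⇒E+2 : ∀ {d} → N d → E (2 + d)
  N⇒E+2 {d} n i p = cross p (subst ((suc i) ~_) (+-suc d i) (n (suc i)))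

  N⇒E-2 : ∀ {d} → N (2 + d) → E d
  N⇒E-2 {d} n i p =
    -- The vertex `2 + c + i` is i - 1 modulo r. Both points of `p` are moved up by r so that this
    -- predecessor exists among the naturals.
    cross (n (2 + c + i)) (subst ((r + i) ~_) (lemma c d i) (wrap (~-sym (wrap (~-sym p)))))
    where
    lemma : ∀ c d i → 3 + c + (d + i) ≡ suc (d + (2 + c + i))
    lemma = solve-∀

  shift-many : ∀ m {d} → 0 ~ (d + 0) → (m * r) ~ (d + m * r)
  shift-many zero    p = p
  shift-many (suc m) {d} p =
    subst ((suc m * r) ~_) (lemma r d (m * r)) (wrap (~-sym (wrap (~-sym (shift-many m p)))))
    where
    lemma : ∀ r d x → r + (d + x) ≡ d + (r + x)
    lemma = solve-∀

  -- Otherwise `i`, `d + i`, `1 + d + i` and `2 + d + i` would be independent.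
  skip : ∀ {d} → E (1 + d) → ∀ {i} → ¬ (i ~ (d + i)) → i ~ (2 + d + i)
  skip {d} e {i} ¬p with i ~? (2 + d + i)
  ... | yes q = q
  ... | no ¬q = ⊥-elim (no-independent-4 ¬p (e i) ¬q (E1 _) (E2 _) (E1 _))

  -- By `skip`, `i` meets `2 + d + i`, and `cross` then keeps `1 + i` from meeting `1 + d + i`. A
  -- failure at distance `d` thus spreads to all later starting points.
  persist : ∀ {d} → E (1 + d) → ∀ {i} → ¬ (i ~ (d + i)) → ∀ j → ¬ ((j + i) ~ (d + (j + i)))
  persist e ¬p zero    = ¬p
  persist {d} e {i} ¬p (suc j) q =
    cross (skip e (persist e ¬p j)) (subst ((suc (j + i)) ~_) (+-suc d (j + i)) q)

  -- Starting point 0 decides. A failure there persists everywhere. A meeting there recurs at every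
  -- multiple of r, whereas a failure at some `i` would persist up to `i * r`.
  dichotomy : ∀ {d} → E (1 + d) → (N d × E (2 + d)) ⊎ (E d × N (2 + d))
  dichotomy {d} e with 0 ~? (d + 0)
  ... | yes p = inj₁ (n , N⇒E+2 n)
    where
    n : N d
    n i with i ~? (d + i)
    ... | yes q = q
    ... | no ¬q = contradiction (shift-many i p)
      (subst (λ x → ¬ (x ~ (d + x))) (m∸n+n≡m (m≤m*n i r)) (persist e ¬q (i * r ∸ i)))
  ... | no ¬p = inj₂ (e′ , λ i → skip e (e′ i))
    where
    e′ : E d
    e′ i = subst (λ x → ¬ (x ~ (d + x))) (+-identityʳ i) (persist e ¬p i)

  -- The distance 3 + s is isolated among the distances at which sets meet.
  record Isolated (s : ℕ) : Set where
    field
      meets : N (3 + s)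
      e₁ : E (1 + s)
      e₂ : E (2 + s)
      e₄ : E (4 + s)
      e₅ : E (5 + s)
  open Isolated

  Both : ℕ → ℕ → ℕ → Set
  Both s x a = x ~ a × x ~ (3 + s + a)

  -- Any choice of one point from each of {a,n+a}, {1+a,n+1+a}, {2+a,n+2+a} (where n = 3 + s)
  -- is independent, so x meets one of the three chosen points.
  window : ∀ {s} → Isolated s → ∀ x a → Both s x a ⊎ Both s x (1 + a) ⊎ Both s x (2 + a)
  window {s} iso x a with pick a | pick (1 + a) | pick (2 + a)
    where
    Missed : ℕ → Set
    Missed y = Σ ℕ λ z → (z ≡ y ⊎ z ≡ 3 + s + y) × ¬ (x ~ z)
    pick : ∀ y → Both s x y ⊎ Missed y
    pick y with x ~? y | x ~? (3 + s + y)
    ... | yes p | yes q = inj₁ (p , q)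
    ... | no ¬p | _     = inj₂ (y , inj₁ refl , ¬p)
    ... | yes _ | no ¬q = inj₂ (3 + s + y , inj₂ refl , ¬q)
  ... | inj₁ b | _ | _ = inj₁ b
  ... | inj₂ _ | inj₁ b | _ = inj₂ (inj₁ b)
  ... | inj₂ _ | inj₂ _ | inj₁ b = inj₂ (inj₂ b)
  ... | inj₂ (z₀ , p₀ , ¬x₀) | inj₂ (z₁ , p₁ , ¬x₁) | inj₂ (z₂ , p₂ , ¬x₂) =
    ⊥-elim (no-independent-4 ¬x₀ ¬x₁ ¬x₂
      (apart (+-comm (2 + s) 1) E1 (e₂ iso) (e₄ iso) p₀ p₁)
      (apart (+-comm (1 + s) 2) E2 (e₁ iso) (e₅ iso) p₀ p₂)
      (apart (+-comm (2 + s) 1) E1 (e₂ iso) (e₄ iso) p₁ p₂))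
    where
    swap : ∀ d n y → d + (n + y) ≡ n + (d + y)
    swap = solve-∀
    assoc : ∀ d n y → d + n + y ≡ n + (d + y)
    assoc = solve-∀
    back : ∀ {d n₋ n y} → n₋ + d ≡ n → n₋ + (d + y) ≡ n + y
    back {d} {n₋} refl = sym (+-assoc n₋ d _)
    -- With n = 3 + s and `n₋` = n - d, the chosen points are at distance d, n + d or n - d.
    apart : ∀ {d n₋ y z w} → n₋ + d ≡ 3 + s → E d → E n₋ → E (d + (3 + s)) →
            z ≡ y ⊎ z ≡ 3 + s + y → w ≡ d + y ⊎ w ≡ 3 + s + (d + y) → ¬ (z ~ w)
    apart       eq e e₋ e₊ (inj₁ refl) (inj₁ refl) = e _
    apart {d}   eq e e₋ e₊ (inj₁ refl) (inj₂ refl) = E-at e₊ (assoc d (3 + s) _)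
    apart {d}   eq e e₋ e₊ (inj₂ refl) (inj₁ refl) = E-at′ e₋ (back {d} eq)
    apart {d}   eq e e₋ e₊ (inj₂ refl) (inj₂ refl) = E-at e (swap d (3 + s) _)

  -- Modulo r, the neighbors of r are the distances -2, -1, 1 and 2.
  isolated-r : Isolated c
  isolated-r = record
    { meets = λ i → wrap (~-refl i)
    ; e₁ = λ i p → E2 _ (wrap (~-sym p))
    ; e₂ = λ i p → E1 _ (wrap (~-sym p))
    ; e₄ = λ i p → E1 i (unwrap (subst (i ~_) (assoc 1 r i) p))
    ; e₅ = λ i p → E2 i (unwrap (subst (i ~_) (assoc 2 r i) p))
    }
    where
    assoc : ∀ d n i → d + n + i ≡ n + (d + i)
    assoc = solve-∀

  -- Put n = 3 + s and n' = 4 + u + s. The window is centered at distance n' - n = 1 + u from `x`.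
  -- Its outer points would make `x` meet a point at distance n' - 1 or n' + 1, so the middle one is
  -- met.
  descend-meets : ∀ {s u} → Isolated s → Isolated (1 + u + s) → N (1 + u)
  descend-meets {s} {u} iso iso′ x with window iso x (u + x)
  ... | inj₁ (_ , q)        = ⊥-elim (E-at (e₂ iso′) (lemma u s x) q)
    where
    lemma : ∀ u s x → 2 + (1 + u + s) + x ≡ 3 + s + (u + x)
    lemma = solve-∀
  ... | inj₂ (inj₁ (p , _)) = p
  ... | inj₂ (inj₂ (_ , q)) = ⊥-elim (E-at (e₄ iso′) (lemma u s x) q)
    where
    lemma : ∀ u s x → 4 + (1 + u + s) + x ≡ 3 + s + (2 + (u + x))
    lemma = solve-∀

  -- Distances two away from 3 + v are excluded by `cross`. If 4 + v were met, `dichotomy` would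
  -- exclude 6 + v as well, and the window at 4 + v would have no admissible point. If 2 + v were
  -- met, the window at v would fail likewise.
  descend : ∀ {s v} → Isolated s → Isolated (3 + v + s) → Isolated v
  descend {s} {v} iso iso′ = record { meets = n ; e₁ = ev₁ ; e₂ = ev₂ ; e₄ = ev₄ ; e₅ = ev₅ }
    where
    n : N (3 + v)
    n = descend-meets iso iso′
    ev₁ : E (1 + v)
    ev₁ = N⇒E-2 n
    ev₅ : E (5 + v)
    ev₅ = N⇒E+2 n

    ev₄ : E (4 + v)
    ev₄ with dichotomy ev₅
    ... | inj₂ (e , _) = e
    ... | inj₁ (_ , ev₆) = λ x p → absurd x (window iso x (4 + v + x))
      where
      lemma₁ : ∀ v s x → 4 + (3 + v + s) + x ≡ 3 + s + (4 + v + x)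
      lemma₁ = solve-∀
      absurd : ∀ x → Both s x (4 + v + x) ⊎ Both s x (5 + v + x) ⊎ Both s x (6 + v + x) → ⊥
      absurd x (inj₁ (_ , q))        = E-at (e₄ iso′) (lemma₁ v s x) q
      absurd x (inj₂ (inj₁ (p , _))) = ev₅ x p
      absurd x (inj₂ (inj₂ (p , _))) = ev₆ x p

    ev₂ : E (2 + v)
    ev₂ with dichotomy ev₁
    ... | inj₁ (_ , e) = e
    ... | inj₂ (ev₀ , _) = λ x p → absurd x (window iso x (v + x))
      where
      lemma₁ : ∀ v s x → 2 + (3 + v + s) + x ≡ 3 + s + (2 + v + x)
      lemma₁ = solve-∀
      absurd : ∀ x → Both s x (v + x) ⊎ Both s x (1 + v + x) ⊎ Both s x (2 + v + x) → ⊥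
      absurd x (inj₁ (p , _))        = ev₀ x p
      absurd x (inj₂ (inj₁ (p , _))) = ev₁ x p
      absurd x (inj₂ (inj₂ (_ , q))) = E-at (e₂ iso′) (lemma₁ v s x) q

  -- The four fields together settle every distance from 1 to 4T + 2, in blocks of four.
  record Pattern (T : ℕ) : Set where
    field
      apart₁ : ∀ {t} → t ≤ T → E (1 + t * 4)
      apart₂ : ∀ {t} → t ≤ T → E (2 + t * 4)
      meets₃ : ∀ {t} → t < T → N (3 + t * 4)
      meets₄ : ∀ {t} → t < T → N (4 + t * 4)
  open Pattern

  pattern-0 : Pattern 0
  pattern-0 = record
    { apart₁ = λ { z≤n → E1 } ; apart₂ = λ { z≤n → E2 } ; meets₃ = λ () ; meets₄ = λ () }

  extend : ∀ {T} → Pattern T → N (3 + T * 4) → N (4 + T * 4) → E (5 + T * 4) → E (6 + T * 4) →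
           Pattern (suc T)
  extend {T} pat n₃ n₄ e₅ e₆ = record
    { apart₁ = λ t≤ → at-most (λ t → E (1 + t * 4)) t≤ (apart₁ pat) e₅
    ; apart₂ = λ t≤ → at-most (λ t → E (2 + t * 4)) t≤ (apart₂ pat) e₆
    ; meets₃ = λ { (s≤s t≤) → below (λ t → N (3 + t * 4)) t≤ (meets₃ pat) n₃ }
    ; meets₄ = λ { (s≤s t≤) → below (λ t → N (4 + t * 4)) t≤ (meets₄ pat) n₄ }
    }
    where
    below : ∀ {T} (P : ℕ → Set) {t} → t ≤ T → (∀ {t} → t < T → P t) → P T → P t
    below P t≤ f p with m≤n⇒m<n∨m≡n t≤
    ... | inj₁ t<   = f t<
    ... | inj₂ refl = p
    at-most : ∀ {T} (P : ℕ → Set) {t} → t ≤ suc T → (∀ {t} → t ≤ T → P t) → P (suc T) → P t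
    at-most P t≤ f = below P t≤ (λ { (s≤s t<) → f t< })

  -- Met distances inside the pattern come in adjacent pairs 4t + 3, 4t + 4, so none of them is
  -- isolated.
  isolated-beyond-pattern : ∀ {T s} → Pattern T → Isolated s → ¬ (s < T * 4)
  isolated-beyond-pattern {T} {s} pat iso s< =
    residue (s % 4) (s div 4) (m≡m%n+[m/n]*n s 4) (m%n<n s 4) (m<n*o⇒m/o<n s<)
    where
    residue : ∀ a q → s ≡ a + q * 4 → a < 4 → q < T → ⊥
    residue 0 q refl _ q< = ¬NE (meets₄ pat q<) (e₄ iso)
    residue 1 q refl _ q< = ¬NE (meets₃ pat q<) (e₂ iso)
    residue 2 q refl _ q< = ¬NE (meets iso) (apart₁ pat q<)
    residue 3 q refl _ q< = ¬NE (meets iso) (apart₂ pat q<)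
    residue (suc (suc (suc (suc _)))) _ _ (s≤s (s≤s (s≤s (s≤s ())))) _

  -- Each step appends a block of four, unless 4T + 4 is unmet; then 4T + 3 is the least positive
  -- isolated distance.
  search : ∀ fuel T → c < fuel + T → Pattern T → Σ ℕ λ T → Pattern T × Isolated (T * 4)
  -- Here T exceeds c, so the pattern would run past the isolated distance r.
  search zero T c< pat = ⊥-elim (isolated-beyond-pattern pat isolated-r (<-≤-trans c< (m≤m*n T 4)))
  search (suc fuel) T c< pat with dichotomy (apart₂ pat ≤-refl)
  ... | inj₁ (n₁ , _) = ⊥-elim (¬NE n₁ (apart₁ pat ≤-refl))
  ... | inj₂ (_ , n₃) with dichotomy (N⇒E+2 n₃)
  ...   | inj₁ (n₄ , e₆) = search fuel (suc T) (subst (c <_) (sym (+-suc fuel T)) c<)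
                             (extend pat n₃ n₄ (N⇒E+2 n₃) e₆)
  ...   | inj₂ (e₄ , _) = T , pat , record
            { meets = n₃ ; e₁ = apart₁ pat ≤-refl ; e₂ = apart₂ pat ≤-refl ; e₄ = e₄ ; e₅ = N⇒E+2 n₃ }

  -- Euclid's algorithm by subtraction: `descend` keeps the difference isolated, and the differences
  -- 1 and 2 contradict `E1` and `E2`.
  isolated⇒multiple : ∀ {T} → Pattern T → Isolated (T * 4) → ∀ fuel {s} → s < fuel → Isolated s →
                      (3 + T * 4) ∣ (3 + s)
  isolated⇒multiple {T} pat iso (suc fuel) {s} (s≤s s≤) iso′ with ≤-total (T * 4) s
  ... | inj₂ s≤T4 with m≤n⇒m<n∨m≡n s≤T4
  ...   | inj₁ s<   = ⊥-elim (isolated-beyond-pattern pat iso′ s<)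
  ...   | inj₂ refl = ∣-refl
  isolated⇒multiple {T} pat iso (suc fuel) {s} (s≤s s≤) iso′ | inj₁ T4≤s =
    go (s ∸ T * 4) (m∸n+n≡m T4≤s)
    where
    go : ∀ u → u + T * 4 ≡ s → (3 + T * 4) ∣ (3 + s)
    go 0 refl = ∣-refl
    go 1 refl = ⊥-elim (¬NE (descend-meets iso iso′) E1)
    go 2 refl = ⊥-elim (¬NE (descend-meets iso iso′) E2)
    go (suc (suc (suc v))) refl =
      subst ((3 + T * 4) ∣_) (lemma (T * 4) v)
        (∣m∣n⇒∣m+n ∣-refl (isolated⇒multiple pat iso fuel v< (descend iso iso′)))
      where
      lemma : ∀ t v → 3 + t + (3 + v) ≡ 3 + (3 + v + t)
      lemma = solve-∀
      v< : v < fuel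
      v< = ≤-trans (s≤s (m≤n⇒m≤o+n 2 (m≤m+n v (T * 4)))) s≤

  cyclic-pattern : Σ ℕ λ T → Pattern T × (3 + T * 4) ∣ r
  cyclic-pattern with search (suc c) 0 (s≤s (m≤m+n c 0)) pattern-0
  ... | T , pat , iso = T , pat , isolated⇒multiple pat iso (suc c) ≤-refl isolated-r

-- Double counting of colors

bit : Bool → ℕ
bit true  = 1
bit false = 0

bit≤1 : ∀ x → bit x ≤ 1
bit≤1 true  = ≤-refl
bit≤1 false = z≤n

multiplicity : ∀ {k} → Fin k → List (Subset k) → ℕ
multiplicity s ps = sum (map (λ p → bit (lookup p s)) ps)

sum-card-∷ : ∀ {k} (ps : List (Subset (suc k))) →
             sum (map card ps) ≡ multiplicity zero ps + sum (map card (map tail ps))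
sum-card-∷ [] = refl
sum-card-∷ ((b ∷ p) ∷ ps) =
  trans (cong₂ _+_ (card-∷ b p) (sum-card-∷ ps))
        (interchange +-commutativeSemigroup (bit b) (card p) (multiplicity zero ps) (sum (map card (map tail ps))))
  where
  card-∷ : ∀ b p → card (b ∷ p) ≡ bit b + card p
  card-∷ true  _ = refl
  card-∷ false _ = refl

multiplicity-tail : ∀ {k} (s : Fin k) (ps : List (Subset (suc k))) →
                    multiplicity s (map tail ps) ≡ multiplicity (suc s) ps
multiplicity-tail s [] = refl
multiplicity-tail s ((b ∷ p) ∷ ps) = cong (_+_ (bit (lookup p s))) (multiplicity-tail s ps)

-- Induction on the number of colors: `tail` removes the first color from every set.
double-count : ∀ {k} (ps : List (Subset k)) m → (∀ s → multiplicity s ps ≤ m) →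
               sum (map card ps) ≤ k * m
double-count {zero} ps m bound = ≤-reflexive (sum-empty ps)
  where
  sum-empty : ∀ (ps : List (Subset 0)) → sum (map card ps) ≡ 0
  sum-empty []        = refl
  sum-empty ([] ∷ ps) = sum-empty ps
double-count {suc k} ps m bound =
  subst (_≤ m + k * m) (sym (sum-card-∷ ps))
    (+-mono-≤ (bound zero)
      (double-count (map tail ps) m (λ s → subst (_≤ m) (sym (multiplicity-tail s ps)) (bound (suc s)))))

sum-uniform : ∀ {k b} {ps : List (Subset k)} → All (λ p → card p ≡ b) ps →
              sum (map card ps) ≡ length ps * b
sum-uniform []         = refl
sum-uniform (eq ∷ eqs) = cong₂ _+_ eq (sum-uniform eqs)

uniform-double-count : ∀ {k b} {ps : List (Subset k)} m → All (λ p → card p ≡ b) ps →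
                       (∀ s → multiplicity s ps ≤ m) → length ps * b ≤ k * m
uniform-double-count {k} {ps = ps} m sizes bound =
  subst (_≤ k * m) (sum-uniform sizes) (double-count ps m bound)

disjoint-multiplicity : ∀ {k} (ps : List (Subset k)) → AllPairs (λ p q → Empty (p ∩ q)) ps →
                        ∀ s → multiplicity s ps ≤ 1
disjoint-multiplicity [] [] s = z≤n
disjoint-multiplicity {k} (p ∷ ps) (disj ∷ rest) s with lookup p s in eq
... | false = disjoint-multiplicity ps rest s
... | true  = s≤s (≤-reflexive (absent ps disj))
  where
  absent : ∀ qs → All (λ q → Empty (p ∩ q)) qs → multiplicity s qs ≡ 0
  absent []       []       = refl
  absent (q ∷ qs) (e ∷ es) with lookup q s in eq′
  ... | false = absent qs es
  ... | true  = ⊥-elim (e (s , x∈p∩q⁺ (lookup⇒[]= s p eq , lookup⇒[]= s q eq′)))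

disjoint-bound : ∀ {k b} (ps : List (Subset k)) → All (λ p → card p ≡ b) ps →
                 AllPairs (λ p q → Empty (p ∩ q)) ps → length ps * b ≤ k
disjoint-bound {k} {b} ps sizes disj =
  subst (length ps * b ≤_) (*-identityʳ k) (uniform-double-count 1 sizes (disjoint-multiplicity ps disj))

positive⇒nonempty : ∀ {k b} (p : Subset k) → card p ≡ suc b → Nonempty p
positive⇒nonempty (true ∷ p)  eq = zero , lookup⇒[]= zero (true ∷ p) refl
positive⇒nonempty (false ∷ p) eq with positive⇒nonempty p eq
... | s , s∈p = suc s , lookup⇒[]= (suc s) (false ∷ p) ([]=⇒lookup s∈p)

-- Occurrences of one color on consecutive vertices.

count : (ℕ → Bool) → ℕ → ℕ → ℕ
count q a n = sum (map bit (applyDownFrom (λ i → q (i + a)) n))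

count-split : ∀ q m n a → count q a (m + n) ≡ count q (n + a) m + count q a n
count-split q zero    n a = refl
count-split q (suc m) n a =
  trans (cong₂ _+_ (cong (λ x → bit (q x)) (+-assoc m n a)) (count-split q m n a))
        (sym (+-assoc (bit (q (m + (n + a)))) _ _))

count-mono : ∀ q a {m n} → m ≤ n → count q a m ≤ count q a n
count-mono q a {m} {n} m≤n = subst (λ n → count q a m ≤ count q a n) (m∸n+n≡m m≤n)
  (subst (count q a m ≤_) (sym (count-split q (n ∸ m) m a)) (m≤n+m _ _))

module Clique (q : ℕ → Bool) (T : ℕ)
  (gap₁ : ∀ {t} i → t ≤ T → q i ≡ true → q ((1 + t * 4) + i) ≡ true → ⊥)
  (gap₂ : ∀ {t} i → t ≤ T → q i ≡ true → q ((2 + t * 4) + i) ≡ true → ⊥)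
  where

  -- After a member v come the pair v+1, v+2 of non-members and then blocks of four, each
  -- made of two non-members and two consecutive numbers that are not both members.
  count-from-member : ∀ v → q v ≡ true → ∀ t → t ≤ T → count q v (3 + t * 4) ≤ suc t
  count-from-member v qv zero _ with q (1 + v) in eq₁ | q (2 + v) in eq₂
  ... | true  | _     = ⊥-elim (gap₁ v z≤n qv eq₁)
  ... | false | true  = ⊥-elim (gap₂ v z≤n qv eq₂)
  ... | false | false = +-mono-≤ (bit≤1 (q v)) z≤n
  count-from-member v qv (suc t) t< =
    subst (_≤ suc (suc t)) (sym (trans (cong (count q v) (comm t)) (count-split q 4 (3 + t * 4) v)))
      (+-mono-≤ block (count-from-member v qv t (≤-trans (n≤1+n t) t<)))
    where
    comm : ∀ t → 3 + (4 + t * 4) ≡ 4 + (3 + t * 4)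
    comm = solve-∀
    w = 3 + t * 4 + v
    block : count q w 4 ≤ 1
    block with q (3 + w) in eq₃ | q (2 + w) in eq₂ | q (1 + w) in eq₁ | q w in eq₀
    ... | true  | _     | _     | _     = ⊥-elim (gap₂ v t< qv eq₃)
    ... | false | true  | _     | _     = ⊥-elim (gap₁ v t< qv eq₂)
    ... | false | false | true  | true  = ⊥-elim (gap₁ w z≤n eq₀ eq₁)
    ... | false | false | true  | false = ≤-refl
    ... | false | false | false | true  = ≤-refl
    ... | false | false | false | false = z≤n

  count-bound : ∀ n a → n ≤ 3 + T * 4 → count q a n ≤ suc T
  count-bound zero    a _  = z≤n
  count-bound (suc n) a n≤ with q a in eq
  ... | true  = ≤-trans (count-mono q a n≤) (count-from-member a eq T ≤-refl)
  ... | false = subst (_≤ suc T) (sym drop-first) (count-bound n (suc a) (≤-trans (n≤1+n n) n≤))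
    where
    drop-first : count q a (suc n) ≡ count q (suc a) n
    drop-first = trans (cong (count q a) (+-comm 1 n))
      (trans (count-split q n 1 a) (trans (cong (λ x → count q (suc a) n + (bit x + 0)) eq) (+-identityʳ _)))

-- Bounds from a coloring of the cycle.

module CycleColoring
  {c b k : ℕ} (r≥3 : 3 ≤ 3 + c) (b>0 : 0 < b)
  (f : Fin (3 + c) → Subset k) (col : IsOrientedColoring (directedCycle (3 + c) r≥3) b k f) where

  r : ℕ
  r = 3 + c

  open IsOrientedColoring col

  vertex : ℕ → Fin r
  vertex i = fromℕ< (m%n<n i r)

  A : ℕ → Subset k
  A i = f (vertex i)

  infix 4 _~_
  -- A record rather than a synonym, so that `i` and `j` can be inferred from a proof of `i ~ j`.
  record _~_ (i j : ℕ) : Set where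
    constructor meet
    field common : Nonempty (A i ∩ A j)

  _~?_ : ∀ i j → Dec (i ~ j)
  i ~? j = map′ meet _~_.common (nonempty? (A i ∩ A j))

  vertex-cong : ∀ {i j} → i % r ≡ j % r → vertex i ≡ vertex j
  vertex-cong eq = fromℕ<-cong _ _ eq _ _

  arc : ∀ i → CycleArc r (vertex i) (vertex (suc i))
  arc i = trans (toℕ-fromℕ< _) (trans (suc-% i) (cong (λ x → suc x % r) (sym (toℕ-fromℕ< (m%n<n i r)))))
    where
    suc-% : ∀ i → suc i % r ≡ suc (i % r) % r
    suc-% i = trans (%-distribˡ-+ 1 i r)
      (sym (trans (%-distribˡ-+ 1 (i % r) r) (cong (λ x → (1 % r + x) % r) (m%n%n≡m%n i r))))

  A-periodic : ∀ j → A (r + j) ≡ A j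
  A-periodic j = cong f (vertex-cong {r + j} {j} (trans (cong (_% r) (+-comm r j)) ([m+n]%n≡m%n j r)))

  ~-refl : ∀ i → i ~ i
  ~-refl i = meet (subst Nonempty (sym (∩-idem (A i)))
    (positive⇒nonempty (A i) (trans (size (vertex i)) (sym (suc-pred b {{>-nonZero b>0}})))))

  ~-sym : ∀ {i j} → i ~ j → j ~ i
  ~-sym {i} {j} (meet p) = meet (subst Nonempty (∩-comm (A i) (A j)) p)

  cross : ∀ {i j} → i ~ suc j → ¬ (suc i ~ j)
  cross {i} {j} (meet p) (meet q) = oriented (arc i) (arc j) p q

  sizes : ∀ is → All (λ p → card p ≡ b) (map A is)
  sizes is = All.map⁺ (All.universal (λ i → size (vertex i)) is)

  independent-bound : ∀ is → AllPairs (λ i j → ¬ (i ~ j)) is → length is * b ≤ k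
  independent-bound is disj =
    subst (λ l → l * b ≤ k) (length-map A is) (disjoint-bound (map A is) (sizes is) (pairs disj))
    where
    pairs : ∀ {is} → AllPairs (λ i j → ¬ (i ~ j)) is → AllPairs (λ p q → Empty (p ∩ q)) (map A is)
    pairs ds = AllPairs.map⁺ (AllPairs.map (λ ¬i~j p → ¬i~j (meet p)) ds)

  unwrap : ∀ {i j} → i ~ (r + j) → i ~ j
  unwrap {i} {j} (meet p) = meet (subst (λ p → Nonempty (A i ∩ p)) (A-periodic j) p)

  wrap : ∀ {i j} → i ~ j → i ~ (r + j)
  wrap {i} {j} (meet p) = meet (subst (λ p → Nonempty (A i ∩ p)) (sym (A-periodic j)) p)

  near₁ : ∀ i → ¬ (i ~ 1 + i)
  near₁ i p = cross p (~-sym p)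

  near₂ : ∀ i → ¬ (i ~ 2 + i)
  near₂ i p = cross p (~-refl (suc i))

  bound-3 : 3 * b ≤ k
  bound-3 = independent-bound (0 ∷ 1 ∷ 2 ∷ [])
    ((near₁ 0 ∷ near₂ 0 ∷ []) ∷ (near₁ 1 ∷ []) ∷ [] ∷ [])

  -- Counts the pairs of a color and a vertex carrying it among 3 + 4T consecutive vertices; by
  -- `Clique` a color lies in at most T + 1 such pairs.
  clique-bound : ∀ T → (∀ {t} → t ≤ T → ∀ i → ¬ (i ~ (1 + t * 4 + i))) →
                 (∀ {t} → t ≤ T → ∀ i → ¬ (i ~ (2 + t * 4 + i))) →
                 (3 + T * 4) * b ≤ k * suc T
  clique-bound T apart₁ apart₂ = subst (λ l → l * b ≤ k * suc T) (length-applyDownFrom A₀ (3 + T * 4))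
    (uniform-double-count (suc T) (All.applyDownFrom⁺₂ A₀ (3 + T * 4) (λ i → size (vertex (i + 0))))
      (λ s → subst (_≤ suc T) (count≡multiplicity s (3 + T * 4)) (bound s)))
    where
    A₀ : ℕ → Subset k
    A₀ i = A (i + 0)
    count≡multiplicity : ∀ s n → count (λ i → lookup (A i) s) 0 n ≡ multiplicity s (applyDownFrom A₀ n)
    count≡multiplicity s zero    = refl
    count≡multiplicity s (suc n) = cong (_+_ (bit (lookup (A₀ n) s))) (count≡multiplicity s n)
    bound : ∀ s → count (λ i → lookup (A i) s) 0 (3 + T * 4) ≤ suc T
    bound s = Clique.count-bound (λ i → lookup (A i) s) T
      (λ i t≤ p q → apart₁ t≤ i (both p q)) (λ i t≤ p q → apart₂ t≤ i (both p q)) (3 + T * 4) 0 ≤-refl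
      where
      both : ∀ {i j} → lookup (A i) s ≡ true → lookup (A j) s ≡ true → i ~ j
      both {i} {j} p q = meet (s , x∈p∩q⁺ (lookup⇒[]= s (A i) p , lookup⇒[]= s (A j) q))

  cyclic-bound : k < 4 * b → Σ ℕ λ T → (3 + T * 4) ∣ r × (3 + T * 4) * b ≤ k * suc T
  cyclic-bound k<4b with CyclicPattern.cyclic-pattern _~_ _~?_ ~-refl ~-sym c unwrap wrap cross no-independent-4
    where
    no-independent-4 : ∀ {w x y z} → ¬ (w ~ x) → ¬ (w ~ y) → ¬ (w ~ z) →
                       ¬ (x ~ y) → ¬ (x ~ z) → ¬ (y ~ z) → ⊥
    no-independent-4 {w} {x} {y} {z} wx wy wz xy xz yz = <-irrefl refl (<-≤-trans k<4b
      (independent-bound (w ∷ x ∷ y ∷ z ∷ [])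
        ((wx ∷ wy ∷ wz ∷ []) ∷ (xy ∷ xz ∷ []) ∷ (yz ∷ []) ∷ [] ∷ [])))
  ... | T , pat , n∣r = T , n∣r , clique-bound T (apart₁ pat) (apart₂ pat)
    where open CyclicPattern.Pattern

-- From one coloring to the fractional number

image : ∀ {b k} → (Fin b → Fin k) → Subset k
image {zero}  g = ∅
image {suc b} g = image (λ i → g (suc i)) [ g zero ]≔ inside

∈-insert⁻ : ∀ {k} (p : Subset k) x {s} → s ∈ p [ x ]≔ inside → s ≡ x ⊎ s ∈ p
∈-insert⁻ (_ ∷ p) zero    here        = inj₁ refl
∈-insert⁻ (_ ∷ p) zero    (there s∈)  = inj₂ (there s∈)
∈-insert⁻ (_ ∷ p) (suc x) here        = inj₂ here
∈-insert⁻ (_ ∷ p) (suc x) (there s∈) with ∈-insert⁻ p x s∈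
... | inj₁ eq  = inj₁ (cong suc eq)
... | inj₂ s∈p = inj₂ (there s∈p)

card-insert : ∀ {k} (p : Subset k) x → x ∉ p → card (p [ x ]≔ inside) ≡ suc (card p)
card-insert (true  ∷ p) zero    x∉ = contradiction here x∉
card-insert (false ∷ p) zero    x∉ = refl
card-insert (true  ∷ p) (suc x) x∉ = cong suc (card-insert p x (λ x∈ → x∉ (there x∈)))
card-insert (false ∷ p) (suc x) x∉ = card-insert p x (λ x∈ → x∉ (there x∈))

∈-image⁻ : ∀ {b k} (g : Fin b → Fin k) {s} → s ∈ image g → Σ (Fin b) λ i → s ≡ g i
∈-image⁻ {zero}  g s∈ = ⊥-elim (∉⊥ s∈)
∈-image⁻ {suc b} g s∈ with ∈-insert⁻ (image (λ i → g (suc i))) (g zero) s∈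
... | inj₁ eq = zero , eq
... | inj₂ s∈′ with ∈-image⁻ (λ i → g (suc i)) s∈′
...   | i , eq = suc i , eq

card-image : ∀ {b k} (g : Fin b → Fin k) → (∀ {i j} → g i ≡ g j → i ≡ j) → card (image g) ≡ b
card-image {zero}  {k} g inj = ∣⊥∣≡0 k
card-image {suc b} g inj =
  trans (card-insert _ (g zero) fresh)
        (cong suc (card-image (λ i → g (suc i)) (λ eq → Fin.suc-injective (inj eq))))
  where
  fresh : g zero ∉ image (λ i → g (suc i))
  fresh z∈ with ∈-image⁻ (λ i → g (suc i)) z∈
  ... | i , eq with inj eq
  ...   | ()

-- A homomorphism from G to the graph of m-sets of an oriented graph on K colors, in which
-- an m-set precedes another when every color of the first has an arc to every color of the
-- second; the m-sets are enumerated.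
record MultiColoring (G : OrientedGraph) (m K : ℕ) : Set₁ where
  open OrientedGraph G
  field
    _⟶_       : Rel (Fin K) 0ℓ
    ⟶-asym    : Asymmetric _⟶_
    color     : Vertex → Fin m → Fin K
    injective : ∀ x {i j} → color x i ≡ color x j → i ≡ j
    arcs      : ∀ {x y} → Arc x y → ∀ i j → color x i ⟶ color y j

module _ {G : OrientedGraph} where
  open OrientedGraph G using (Vertex)

  -- A color shared along an arc would have an arc to itself. A violation of the second axiom, with
  -- common colors s and t, would give both s ⟶ t and t ⟶ s.
  colorable : ∀ {b k} → MultiColoring G b k → OrientedColorable G b k
  colorable {b} {k} mc = (λ x → image (color x)) , record
    { size = λ x → card-image (color x) (injective x)
    ; proper = λ {x} {y} a (s , s∈) → proper a (x∈p∩q⁻ (image (color x)) (image (color y)) s∈)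
    ; oriented = λ {x} {y} {z} {w} a a′ (s , s∈) (t , t∈) →
        oriented a a′ (x∈p∩q⁻ (image (color x)) (image (color w)) s∈)
                      (x∈p∩q⁻ (image (color y)) (image (color z)) t∈)
    }
    where
    open MultiColoring mc
    open OrientedGraph G using (Arc)
    arc-between : ∀ {x y} → Arc x y → ∀ {s t} → s ∈ image (color x) → t ∈ image (color y) → s ⟶ t
    arc-between {x} {y} a s∈ t∈ with ∈-image⁻ (color x) s∈ | ∈-image⁻ (color y) t∈
    ... | i , refl | j , refl = arcs a i j
    proper : ∀ {x y} → Arc x y → ∀ {s} → s ∈ image (color x) × s ∈ image (color y) → ⊥
    proper a (p , q) = ⟶-asym (arc-between a p q) (arc-between a p q)
    oriented : ∀ {x y z w} → Arc x y → Arc z w → ∀ {s t} → s ∈ image (color x) × s ∈ image (color w) →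
               t ∈ image (color y) × t ∈ image (color z) → ⊥
    oriented a a′ (p , q) (p′ , q′) = ⟶-asym (arc-between a p p′) (arc-between a′ q′ q)

  -- Each color is replaced by `t` copies that inherit its arcs. Every vertex then has `m * t`
  -- colors, of which the first `b` are kept.
  blow-up : ∀ {m K} → MultiColoring G m K → ∀ t {b} → b ≤ m * t → MultiColoring G b (K * t)
  blow-up {m} {K} mc t {b} b≤ = record
    { _⟶_ = λ s u → quotient {K} t s ⟶ quotient {K} t u
    ; ⟶-asym = ⟶-asym
    ; color = color′
    ; injective = λ x {i} {j} eq → inject≤-injective b≤ b≤ i j (inj x eq)
    ; arcs = λ {x} {y} a i j →
        subst₂ _⟶_ (sym (quotient-color x i)) (sym (quotient-color y j)) (arcs a _ _)
    }
    where
    open MultiColoring mc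
    split : Fin (m * t) → Fin m × Fin t
    split = remQuot {m} t
    color′ : Vertex → Fin b → Fin (K * t)
    color′ x i = combine (color x (proj₁ (split (inject≤ i b≤)))) (proj₂ (split (inject≤ i b≤)))
    quotient-color : ∀ x i → quotient {K} t (color′ x i) ≡ color x (proj₁ (split (inject≤ i b≤)))
    quotient-color x i = cong proj₁ (remQuot-combine {K} _ _)
    inj : ∀ x {i j} → color′ x i ≡ color′ x j → inject≤ i b≤ ≡ inject≤ j b≤
    inj x {i} {j} eq = trans (sym (combine-remQuot {m} t _))
      (trans (cong₂ combine (injective x (,-injectiveˡ same)) (,-injectiveʳ same)) (combine-remQuot {m} t _))
      where
      same = trans (sym (remQuot-combine {K} _ _)) (trans (cong (remQuot {K} t) eq) (remQuot-combine {K} _ _))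

-- Decidability of colorability and existence of minima.

-- Exhaustive search over families of subsets; closure under pointwise equality stands in for
-- function extensionality.
any-family? : ∀ {k} r {P : (Fin r → Subset k) → Set} → (∀ {f g} → f ≗ g → P f → P g) →
              Decidable P → Dec (Σ (Fin r → Subset k) P)
any-family? zero resp P? with P? Vector.[]
... | yes p = yes (Vector.[] , p)
... | no ¬p = no λ (f , p) → ¬p (resp (λ ()) p)
any-family? (suc r) {P} resp P? =
  map′ (λ (a , f , p) → (a Vector.∷ f) , p)
       (λ (f , p) → f zero , (λ i → f (suc i)) , resp (λ { zero → refl ; (suc i) → refl }) p)
       (anySubset? λ a → any-family? r {λ f → P (a Vector.∷ f)}
         (λ eq → resp (λ { zero → refl ; (suc i) → eq i })) (λ f → P? (a Vector.∷ f)))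

module Least {P : ℕ → Set} (P? : Decidable P) where

  Least : Set
  Least = Σ ℕ λ k → P k × (∀ j → P j → k ≤ j)

  least-below : ∀ n → Least ⊎ (∀ {j} → j < n → ¬ P j)
  least-below zero = inj₂ λ ()
  least-below (suc n) with least-below n
  ... | inj₁ l = inj₁ l
  ... | inj₂ none with P? n
  ...   | yes p = inj₁ (n , p , λ j pj → ≮⇒≥ (λ j<n → none j<n pj))
  ...   | no ¬p = inj₂ λ { {j} (s≤s j≤n) pj → cases (m≤n⇒m<n∨m≡n j≤n) pj }
    where
    cases : ∀ {j} → j < n ⊎ j ≡ n → ¬ P j
    cases (inj₁ j<n)  = none j<n
    cases (inj₂ refl) = ¬p

  least : ∀ {n} → P n → Least
  least {n} p with least-below (suc n)
  ... | inj₁ l = l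
  ... | inj₂ none = contradiction p (none ≤-refl)

module _ {r} (r≥3 : 3 ≤ r) where
  private
    C = directedCycle r r≥3
    instance
      r≢0 : NonZero r
      r≢0 = >-nonZero (≤-trans (s≤s z≤n) r≥3)

  isColoring? : ∀ b k → Decidable (IsOrientedColoring C b k)
  isColoring? b k f = map′
    (λ (p , q , o) → record { size = p ; proper = λ {x} {y} → q x y ; oriented = λ {x} {y} {z} {w} → o x y z w })
    (λ col → let open IsOrientedColoring col in
      size , (λ x y → proper) , (λ x y z w → oriented))
    (all? (λ x → card (f x) ≟ b)
     ×-dec all? (λ x → all? λ y → arc? x y →-dec ¬? (nonempty? (f x ∩ f y)))
     ×-dec all? (λ x → all? λ y → all? λ z → all? λ w →
       arc? x y →-dec arc? z w →-dec nonempty? (f x ∩ f w) →-dec ¬? (nonempty? (f y ∩ f z))))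
    where
    arc? : ∀ x y → Dec (CycleArc r x y)
    arc? x y = toℕ y ≟ suc (toℕ x) % r

  isColoring-resp : ∀ {b k} {f g : Fin r → Subset k} → f ≗ g →
                    IsOrientedColoring C b k f → IsOrientedColoring C b k g
  isColoring-resp {f = f} {g} eq col = record
    { size = λ x → trans (cong card (sym (eq x))) (size x)
    ; proper = λ {x} {y} a p → proper a (subst Nonempty (meets (sym (eq x)) (sym (eq y))) p)
    ; oriented = λ {x} {y} {z} {w} a a′ p q →
        oriented a a′ (subst Nonempty (meets (sym (eq x)) (sym (eq w))) p)
                      (subst Nonempty (meets (sym (eq y)) (sym (eq z))) q)
    }
    where
    open IsOrientedColoring col
    meets : ∀ {k} {p p′ q q′ : Subset k} → p ≡ p′ → q ≡ q′ → p ∩ q ≡ p′ ∩ q′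
    meets = cong₂ _∩_

  colorable? : ∀ b → Decidable (OrientedColorable C b)
  colorable? b k = any-family? r isColoring-resp (isColoring? b k)

-- Limit and infimum of the ratios.

p+q-q≡p : ∀ p q → p ℚ.+ q ℚ.- q ≡ p
p+q-q≡p p q = trans (ℚ.+-assoc p q (ℚ.- q)) (trans (cong (p ℚ.+_) (ℚ.+-inverseʳ q)) (ℚ.+-identityʳ p))

ratio-≤ : ∀ k m .{{_ : NonZero m}} l n .{{_ : NonZero n}} → k * n ≤ l * m → + k / m ℚ.≤ + l / n
ratio-≤ k m@(suc m-1) l n@(suc n-1) le = ℚ.toℚᵘ-cancel-≤ (begin
  toℚᵘ (+ k / m) ≃⟨ ℚ.toℚᵘ-fromℚᵘ (mkℚᵘ (+ k) m-1) ⟩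
  mkℚᵘ (+ k) m-1 ≤⟨ ℚᵘ.*≤* (subst₂ ℤ._≤_ (ℤ.pos-* k n) (ℤ.pos-* l m) (ℤ.+≤+ le)) ⟩
  mkℚᵘ (+ l) n-1 ≃⟨ ℚ.toℚᵘ-fromℚᵘ (mkℚᵘ (+ l) n-1) ⟨
  toℚᵘ (+ l / n) ∎)
  where open ℚᵘ.≤-Reasoning

-- The hypothesis on x says x / b ≤ K / m + K / b. With ε = n / d and n ≥ 1, K / b < ε as soon as b
-- > K d.
ratio-<-+ : ∀ ε → 0ℚ ℚ.< ε → ∀ K m .{{_ : NonZero m}} →
            Σ ℕ λ N → ∀ x b .{{_ : NonZero b}} → N ≤ b → m * x ≤ K * (b + m) → + x / b ℚ.< ε ℚ.+ + K / m
ratio-<-+ (ℚ.mkℚ ℤ.+0 d-1 _) (ℚ.*<* (+<+ ())) K m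
ratio-<-+ (ℚ.mkℚ ℤ.-[1+ n ] d-1 _) (ℚ.*<* ()) K m
ratio-<-+ ε@(ℚ.mkℚ ℤ.+[1+ n-1 ] d-1 _) _ K m@(suc m-1) = suc (K * d) , bound
  where
  n = suc n-1
  d = suc d-1
  arith : ∀ x b → K * d < b → m * x ≤ K * (b + m) → x * (d * m) < (n * m + K * d) * b
  arith x b Kd<b le = begin-strict
    x * (d * m)             ≡⟨ lemma₁ x d m ⟩
    m * x * d               ≤⟨ *-monoˡ-≤ d le ⟩
    K * (b + m) * d         ≡⟨ lemma₂ K b m d ⟩
    m * (K * d) + K * d * b <⟨ +-monoˡ-< (K * d * b) (*-monoʳ-< m Kd<b) ⟩
    m * b + K * d * b       ≤⟨ +-monoˡ-≤ (K * d * b) (*-monoˡ-≤ b (m≤n*m m n)) ⟩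
    n * m * b + K * d * b   ≡⟨ *-distribʳ-+ b (n * m) (K * d) ⟨
    (n * m + K * d) * b     ∎
    where
    open ≤-Reasoning
    lemma₁ : ∀ x d m → x * (d * m) ≡ m * x * d
    lemma₁ = solve-∀
    lemma₂ : ∀ K b m d → K * (b + m) * d ≡ m * (K * d) + K * d * b
    lemma₂ = solve-∀
  bound : ∀ x b .{{_ : NonZero b}} → suc (K * d) ≤ b → m * x ≤ K * (b + m) → + x / b ℚ.< ε ℚ.+ + K / m
  bound x b@(suc b-1) N≤b le = ℚ.toℚᵘ-cancel-< (begin-strict
    toℚᵘ (+ x / b)                           ≃⟨ ℚ.toℚᵘ-fromℚᵘ (mkℚᵘ (+ x) b-1) ⟩
    mkℚᵘ (+ x) b-1                           <⟨ ℚᵘ.*<* integers ⟩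
    mkℚᵘ (+ n) d-1 ℚᵘ.+ mkℚᵘ (+ K) m-1       ≃⟨ ℚᵘ.+-congʳ (toℚᵘ ε) (ℚ.toℚᵘ-fromℚᵘ (mkℚᵘ (+ K) m-1)) ⟨
    toℚᵘ ε ℚᵘ.+ toℚᵘ (+ K / m)               ≃⟨ ℚ.toℚᵘ-homo-+ ε (+ K / m) ⟨
    toℚᵘ (ε ℚ.+ + K / m)                     ∎)
    where
    open ℚᵘ.≤-Reasoning
    integers : + x ℤ.* + (d * m) ℤ.< (+ n ℤ.* + m ℤ.+ + K ℤ.* + d) ℤ.* + b
    integers = subst₂ ℤ._<_ (ℤ.pos-* x (d * m))
      (trans (ℤ.pos-* (n * m + K * d) b)
        (cong (ℤ._* + b) (trans (ℤ.pos-+ (n * m) (K * d)) (cong₂ ℤ._+_ (ℤ.pos-* n m) (ℤ.pos-* K d)))))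
      (+<+ (arith x b N≤b le))

chromatic-number : ∀ {r} (r≥3 : 3 ≤ r) {b k} → OrientedColorable (directedCycle r r≥3) b k →
                   Σ ℕ (IsOrientedChromaticNumber (directedCycle r r≥3) b)
chromatic-number r≥3 {b} col with Least.least (colorable? r≥3 b) col
... | k , col′ , least = k , record { colorable = col′ ; minimal = least }

module Squeeze {G : OrientedGraph} (m K : ℕ) .{{_ : NonZero m}}
  (upper : MultiColoring G m K)
  (lower : ∀ {b k} → 0 < b → OrientedColorable G b k → K * b ≤ k * m)
  (χ : ℕ → ℕ) (χ-isNumber : ∀ b .{{_ : NonZero b}} → IsOrientedChromaticNumber G b (χ b)) where

  open module Number b .{{_ : NonZero b}} = IsOrientedChromaticNumber (χ-isNumber b)
    renaming (colorable to χ-colorable; minimal to χ-minimal)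

  χ-lower : ∀ b .{{_ : NonZero b}} → + K / m ℚ.≤ + χ b / b
  χ-lower b@(suc _) = ratio-≤ K m (χ b) b (lower (s≤s z≤n) (χ-colorable b))

  -- With t = 1 + floor(b / m), a blow-up by t has room for b colors at each vertex, and m t ≤ b +
  -- m.
  χ-upper : ∀ b .{{_ : NonZero b}} → m * χ b ≤ K * (b + m)
  χ-upper b = begin
    m * χ b                  ≤⟨ *-monoʳ-≤ m (χ-minimal b (K * t) (colorable (blow-up upper t (<⇒≤ b<mt)))) ⟩
    m * (K * t)              ≡⟨ lemma m K (b div m) ⟩
    K * ((b div m) * m + m)  ≤⟨ *-monoʳ-≤ K (+-monoˡ-≤ m (m/n*n≤m b m)) ⟩
    K * (b + m)              ∎
    where
    open ≤-Reasoning
    t = suc (b div m)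
    lemma : ∀ m K q → m * (K * suc q) ≡ K * (q * m + m)
    lemma = solve-∀
    b<mt : b < m * t
    b<mt = begin-strict
      b                      ≡⟨ m≡m%n+[m/n]*n b m ⟩
      b % m + (b div m) * m  <⟨ +-monoˡ-< _ (m%n<n b m) ⟩
      m + (b div m) * m      ≡⟨ *-comm t m ⟩
      m * t                  ∎

  -- The given coloring itself serves for b = m, so the infimum is attained there.
  χm≤K : χ m ≤ K
  χm≤K = subst (χ m ≤_) (*-identityʳ K)
    (χ-minimal m (K * 1) (colorable (blow-up upper 1 (≤-reflexive (sym (*-identityʳ m))))))

  limit : IsLimit (λ b → + χ b / b) (+ K / m)
  limit ε ε>0 with ratio-<-+ ε ε>0 K m
  ... | N , bound = N , λ b N≤b → close (χ-lower b) (bound (χ b) b N≤b (χ-upper b))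
    where
    close : ∀ {a q} → q ℚ.≤ a → a ℚ.< ε ℚ.+ q → ℚ.∣ a ℚ.- q ∣ ℚ.< ε
    close {a} {q} le lt = subst₂ ℚ._<_ (sym (ℚ.0≤p⇒∣p∣≡p nonneg)) (p+q-q≡p ε q) (ℚ.+-monoˡ-< (ℚ.- q) lt)
      where
      nonneg : 0ℚ ℚ.≤ a ℚ.- q
      nonneg = subst (ℚ._≤ a ℚ.- q) (ℚ.+-inverseʳ q) (ℚ.+-monoˡ-≤ (ℚ.- q) le)

  isFractional : IsFractionalOrientedChromaticNumber G (+ K / m)
  isFractional = record
    { χ = χ
    ; χ-isNumber = χ-isNumber
    ; isLimit = limit
    ; isInfimum = record
      { lowerBound = λ b → χ-lower b
      ; greatest = λ ℓ ℓ≤ → ℚ.≤-trans (ℓ≤ m) (ratio-≤ (χ m) m K m (*-monoˡ-≤ m χm≤K))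
      }
    }

fractional-number : ∀ {r} (r≥3 : 3 ≤ r) (let C = directedCycle r r≥3) m K .{{_ : NonZero m}} →
  MultiColoring C m K → (∀ {b k} → 0 < b → OrientedColorable C b k → K * b ≤ k * m) →
  IsFractionalOrientedChromaticNumber C (+ K / m)
fractional-number r≥3 m K upper lower = Squeeze.isFractional m K upper lower
  (λ b → proj₁ (χ b)) (λ b → proj₂ (χ b))
  where
  χ : ∀ b → Σ ℕ (IsOrientedChromaticNumber (directedCycle _ r≥3) b)
  χ b = chromatic-number r≥3 (colorable (blow-up upper b (m≤n*m b m)))

-- Colorings of directed cycles

%-+-congʳ : ∀ a {b c} p .{{_ : NonZero p}} → b % p ≡ c % p → (a + b) % p ≡ (a + c) % p
%-+-congʳ a {b} {c} p eq =
  trans (%-distribˡ-+ a b p) (trans (cong (λ x → (a % p + x) % p) eq) (sym (%-distribˡ-+ a c p)))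

%-*-congʳ : ∀ a {b c} p .{{_ : NonZero p}} → b % p ≡ c % p → (a * b) % p ≡ (a * c) % p
%-*-congʳ a {b} {c} p eq =
  trans (%-distribˡ-* a b p) (trans (cong (λ x → (a % p * x) % p) eq) (sym (%-distribˡ-* a c p)))

%-fixed⇒∣ : ∀ d s p .{{_ : NonZero p}} → (d + s) % p ≡ s % p → p ∣ d
%-fixed⇒∣ d s p eq = ∣m+n∣m⇒∣n (divides ((d + s) div p) multiple) (n∣m*n (s div p))
  where
  multiple : (s div p) * p + d ≡ ((d + s) div p) * p
  multiple = +-cancelˡ-≡ (s % p) _ _ (begin
    s % p + ((s div p) * p + d)        ≡⟨ +-assoc (s % p) _ d ⟨
    s % p + (s div p) * p + d          ≡⟨ cong (_+ d) (m≡m%n+[m/n]*n s p) ⟨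
    s + d                              ≡⟨ +-comm s d ⟩
    d + s                              ≡⟨ m≡m%n+[m/n]*n (d + s) p ⟩
    (d + s) % p + ((d + s) div p) * p  ≡⟨ cong (_+ ((d + s) div p) * p) eq ⟩
    s % p + ((d + s) div p) * p        ∎)
    where open ≡-Reasoning

%-fixed⇒0 : ∀ {d} s {p} .{{_ : NonZero p}} → d < p → (d + s) % p ≡ s % p → d ≡ 0
%-fixed⇒0 {zero}  s {p} d<p eq = refl
%-fixed⇒0 {suc d} s {p} d<p eq = contradiction (%-fixed⇒∣ (suc d) s p eq) (>⇒∤ d<p)

module Rotational {r} (r≥3 : 3 ≤ r) (T : ℕ) where
  private
    p = 3 + T * 4
    instance
      r≢0 : NonZero r
      r≢0 = >-nonZero (≤-trans (s≤s z≤n) r≥3)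

  infix 4 _⟶_
  _⟶_ : Fin p → Fin p → Set
  s ⟶ t = Σ ℕ λ e → 1 ≤ e × e ≤ 1 + T * 2 × toℕ t ≡ (e + toℕ s) % p

  -- Going forth and back advances by e + e', at most 4T + 2 < p, and returns to the start modulo p.
  -- This forces e + e' = 0, against e ≥ 1.
  ⟶-asym : Asymmetric _⟶_
  ⟶-asym {s} {t} (e , 1≤e , e≤ , eq) (e′ , _ , e′≤ , eq′) =
    <⇒≢ (≤-trans 1≤e (m≤n+m e e′)) (sym (%-fixed⇒0 (toℕ s) e′+e<p returns))
    where
    returns : (e′ + e + toℕ s) % p ≡ toℕ s % p
    returns = begin
      (e′ + e + toℕ s) % p          ≡⟨ cong (_% p) (+-assoc e′ e (toℕ s)) ⟩
      (e′ + (e + toℕ s)) % p        ≡⟨ %-+-congʳ e′ p (m%n%n≡m%n (e + toℕ s) p) ⟨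
      (e′ + (e + toℕ s) % p) % p    ≡⟨ cong (λ x → (e′ + x) % p) eq ⟨
      (e′ + toℕ t) % p              ≡⟨ eq′ ⟨
      toℕ s                         ≡⟨ m<n⇒m%n≡m (toℕ<n s) ⟨
      toℕ s % p                     ∎
      where open ≡-Reasoning
    e′+e<p : e′ + e < p
    e′+e<p = s≤s (≤-trans (+-mono-≤ e′≤ e≤) (≤-reflexive (lemma T)))
      where
      lemma : ∀ T → 1 + T * 2 + (1 + T * 2) ≡ 2 + T * 4
      lemma = solve-∀

  index : Fin r → Fin (suc T) → ℕ
  index x j = suc T * toℕ x + toℕ j

  -- For T = 0 this is the map to the directed triangle, which serves lengths divisible by 3.
  coloring : p ∣ r → MultiColoring (directedCycle r r≥3) (suc T) p
  coloring p∣r = record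
    { _⟶_ = _⟶_
    ; ⟶-asym = ⟶-asym
    ; color = color
    ; injective = injective
    ; arcs = λ {x} {y} → arcs {x} {y}
    }
    where
    color : Fin r → Fin (suc T) → Fin p
    color x j = fromℕ< (m%n<n (index x j) p)

    toℕ-color : ∀ x j → toℕ (color x j) ≡ index x j % p
    toℕ-color x j = toℕ-fromℕ< (m%n<n (index x j) p)

    ordered : ∀ a {i j} → i ≤ j → j < p → (a + i) % p ≡ (a + j) % p → i ≡ j
    ordered a {i} {j} i≤j j<p eq = ≤-antisym i≤j (m∸n≡0⇒m≤n
      (%-fixed⇒0 (a + i) (≤-<-trans (m∸n≤m j i) j<p) (trans (cong (_% p) regroup) (sym eq))))
      where
      regroup : j ∸ i + (a + i) ≡ a + j
      regroup = trans (lemma (j ∸ i) a i) (cong (λ x → a + x) (m∸n+n≡m i≤j))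
        where
        lemma : ∀ d a i → d + (a + i) ≡ a + (d + i)
        lemma = solve-∀

    injective : ∀ x {i j} → color x i ≡ color x j → i ≡ j
    injective x {i} {j} eq = toℕ-injective (cases (≤-total (toℕ i) (toℕ j)))
      where
      small : ∀ (i : Fin (suc T)) → toℕ i < p
      small i = <-≤-trans (toℕ<n i) (s≤s (m≤n⇒m≤o+n 2 (m≤m*n T 4)))
      eq′ : index x i % p ≡ index x j % p
      eq′ = trans (sym (toℕ-color x i)) (trans (cong toℕ eq) (toℕ-color x j))
      cases : toℕ i ≤ toℕ j ⊎ toℕ j ≤ toℕ i → toℕ i ≡ toℕ j
      cases (inj₁ i≤j) = ordered (suc T * toℕ x) i≤j (small j) eq′
      cases (inj₂ j≤i) = sym (ordered (suc T * toℕ x) j≤i (small i) (sym eq′))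

    arcs : ∀ {x y} → CycleArc r x y → ∀ i j → color x i ⟶ color y j
    arcs {x} {y} a i j = e , m<n⇒0<n∸m i<1+T+j , e≤ , (begin
      toℕ (color y j)                    ≡⟨ toℕ-color y j ⟩
      (suc T * toℕ y + toℕ j) % p        ≡⟨ cong (_% p) (+-comm _ (toℕ j)) ⟩
      (toℕ j + suc T * toℕ y) % p        ≡⟨ %-+-congʳ (toℕ j) p (%-*-congʳ (suc T) {toℕ y} {suc (toℕ x)} p next) ⟩
      (toℕ j + suc T * suc (toℕ x)) % p  ≡⟨ cong (_% p) regroup ⟩
      (e + index x i) % p                ≡⟨ %-+-congʳ e p (m%n%n≡m%n (index x i) p) ⟨
      (e + index x i % p) % p            ≡⟨ cong (λ z → (e + z) % p) (toℕ-color x i) ⟨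
      (e + toℕ (color x i)) % p          ∎)
      where
      open ≡-Reasoning
      -- The residue advances by T + 1 + j - i, which lies between 1 and 2T + 1 because i, j ≤ T.
      e = suc T + toℕ j ∸ toℕ i
      i<1+T+j : toℕ i < suc T + toℕ j
      i<1+T+j = <-≤-trans (toℕ<n i) (m≤m+n (suc T) (toℕ j))
      e≤ : e ≤ 1 + T * 2
      e≤ = ≤-trans (m∸n≤m _ (toℕ i)) (≤-trans (+-monoʳ-≤ (suc T) (≤-pred (toℕ<n j))) (≤-reflexive (lemma T)))
        where
        lemma : ∀ T → suc T + T ≡ 1 + T * 2
        lemma = solve-∀
      -- Since p divides r, reduction modulo r on the closing arc preserves residues modulo p.
      next : toℕ y % p ≡ suc (toℕ x) % p
      next = trans (cong (_% p) a) (m∣n⇒o%n%m≡o%m p r (suc (toℕ x)) p∣r)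
      regroup : toℕ j + suc T * suc (toℕ x) ≡ e + index x i
      regroup = trans (lemma₁ (toℕ j) T (toℕ x)) (trans
        (cong (λ z → suc T * toℕ x + z) (sym (m∸n+n≡m (<⇒≤ i<1+T+j)))) (lemma₂ (suc T * toℕ x) e (toℕ i)))
        where
        lemma₁ : ∀ j T x → j + suc T * suc x ≡ suc T * x + (suc T + j)
        lemma₁ = solve-∀
        lemma₂ : ∀ a e i → a + (e + i) ≡ e + (a + i)
        lemma₂ = solve-∀

all-equal : ∀ {i j : Fin 1} → i ≡ j
all-equal {zero} {zero} = refl

identity-coloring : ∀ {r} (r≥3 : 3 ≤ r) → MultiColoring (directedCycle r r≥3) 1 r
identity-coloring {r} r≥3 = record
  { _⟶_ = OrientedGraph.Arc C
  ; ⟶-asym = λ {x} {y} → OrientedGraph.asym C {x} {y}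
  ; color = λ x _ → x
  ; injective = λ x _ → all-equal
  ; arcs = λ a _ _ → a
  }
  where C = directedCycle r r≥3

-- The triangle 0 1 2 and the 4-cycle 0 1 2 3 both pass through 0, where closed walks are joined; 1
-- and 3 stay nonadjacent.
data _↝_ : Fin 4 → Fin 4 → Set where
  0↝1 : zero ↝ suc zero
  1↝2 : suc zero ↝ suc (suc zero)
  2↝0 : suc (suc zero) ↝ zero
  2↝3 : suc (suc zero) ↝ suc (suc (suc zero))
  3↝0 : suc (suc (suc zero)) ↝ zero

↝-asym : Asymmetric _↝_
↝-asym 0↝1 ()
↝-asym 1↝2 ()
↝-asym 2↝0 ()
↝-asym 2↝3 ()
↝-asym 3↝0 ()

record ClosedWalk (l : ℕ) : Set where
  field
    at    : ℕ → Fin 4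
    start : at 0 ≡ zero
    end   : at l ≡ zero
    step  : ∀ {i} → i < l → at i ↝ at (suc i)
open ClosedWalk

stay : ClosedWalk 0
stay = record { at = λ _ → zero ; start = refl ; end = refl ; step = λ () }

around-3 : ∀ {l} → ClosedWalk l → ClosedWalk (3 + l)
around-3 {l} w = record { at = at′ ; start = refl ; end = end w ; step = step′ }
  where
  at′ : ℕ → Fin 4
  at′ 0 = zero
  at′ 1 = suc zero
  at′ 2 = suc (suc zero)
  at′ (suc (suc (suc i))) = at w i
  step′ : ∀ {i} → i < 3 + l → at′ i ↝ at′ (suc i)
  step′ {0} _ = 0↝1
  step′ {1} _ = 1↝2
  step′ {2} _ = subst (suc (suc zero) ↝_) (sym (start w)) 2↝0
  step′ {suc (suc (suc i))} (s≤s (s≤s (s≤s i<l))) = step w i<l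

around-4 : ∀ {l} → ClosedWalk l → ClosedWalk (4 + l)
around-4 {l} w = record { at = at′ ; start = refl ; end = end w ; step = step′ }
  where
  at′ : ℕ → Fin 4
  at′ 0 = zero
  at′ 1 = suc zero
  at′ 2 = suc (suc zero)
  at′ 3 = suc (suc (suc zero))
  at′ (suc (suc (suc (suc i)))) = at w i
  step′ : ∀ {i} → i < 4 + l → at′ i ↝ at′ (suc i)
  step′ {0} _ = 0↝1
  step′ {1} _ = 1↝2
  step′ {2} _ = 2↝3
  step′ {3} _ = subst (suc (suc (suc zero)) ↝_) (sym (start w)) 3↝0
  step′ {suc (suc (suc (suc i)))} (s≤s (s≤s (s≤s (s≤s i<l)))) = step w i<l

-- Every length from 6 on is a sum of threes and fours; 6, 7 and 8 start the induction in steps of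
-- 3.
closed-walk : ∀ n → ClosedWalk (6 + n)
closed-walk 0 = around-3 (around-3 stay)
closed-walk 1 = around-3 (around-4 stay)
closed-walk 2 = around-4 (around-4 stay)
closed-walk (suc (suc (suc n))) = around-3 (closed-walk n)

four-coloring : ∀ {r} (r≥3 : 3 ≤ r) → 5 < r → MultiColoring (directedCycle r r≥3) 1 4
four-coloring {r} r≥3 5<r = record
  { _⟶_ = _↝_
  ; ⟶-asym = ↝-asym
  ; color = λ x _ → at w (toℕ x)
  ; injective = λ x _ → all-equal
  ; arcs = λ {x} {y} a _ _ → arcs x y a
  }
  where
  w : ClosedWalk r
  w = subst ClosedWalk (m+[n∸m]≡n 5<r) (closed-walk (r ∸ 6))
  instance
    r≢0 : NonZero r
    r≢0 = >-nonZero (≤-trans (s≤s z≤n) r≥3)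
  next : ∀ i → i < r → at w (suc i) ≡ at w (suc i % r)
  next i i<r with m≤n⇒m<n∨m≡n i<r
  ... | inj₁ 1+i<r = cong (at w) (sym (m<n⇒m%n≡m 1+i<r))
  ... | inj₂ refl  = trans (end w) (trans (sym (start w)) (cong (at w) (sym (n%n≡0 (suc i)))))
  arcs : ∀ x y → CycleArc r x y → at w (toℕ x) ↝ at w (toℕ y)
  arcs x y a = subst (at w (toℕ x) ↝_) (trans (next (toℕ x) (toℕ<n x)) (cong (at w) (sym a)))
    (step w (toℕ<n x))

-- Type-A prime factors.

-- Products of the residues 0, 1 and 2 are never 3 modulo 4.
product-residue-3 : ∀ ps → product ps % 4 ≡ 3 → All Prime ps → Σ ℕ λ p → Prime p × p % 4 ≡ 3 × p ∣ product ps
product-residue-3 (p ∷ ps) eq (p-prime ∷ primes) with p % 4 ≟ 3 | product ps % 4 ≟ 3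
... | yes p≡3 | _ = p , p-prime , p≡3 , m∣m*n (product ps)
... | no _    | yes Π≡3 with product-residue-3 ps Π≡3 primes
...   | q , q-prime , q≡3 , q∣ = q , q-prime , q≡3 , ∣n⇒∣m*n p q∣
product-residue-3 (p ∷ ps) eq (p-prime ∷ primes) | no p≢3 | no Π≢3 =
  contradiction (trans (sym (%-distribˡ-* p (product ps) 4)) eq)
    (residues (p % 4) (product ps % 4) (m%n<n p 4) (m%n<n (product ps) 4) p≢3 Π≢3)
  where
  residues : ∀ a b → a < 4 → b < 4 → a ≢ 3 → b ≢ 3 → (a * b) % 4 ≢ 3
  residues 3 _ _ _ a≢3 _ = contradiction refl a≢3
  residues _ 3 _ _ _ b≢3 = contradiction refl b≢3
  residues 0 _ _ _ _ _ ()
  residues 1 0 _ _ _ _ ()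
  residues 1 1 _ _ _ _ ()
  residues 1 2 _ _ _ _ ()
  residues 2 0 _ _ _ _ ()
  residues 2 1 _ _ _ _ ()
  residues 2 2 _ _ _ _ ()
  residues (suc (suc (suc (suc _)))) _ (s≤s (s≤s (s≤s (s≤s ())))) _ _ _
  residues _ (suc (suc (suc (suc _)))) _ (s≤s (s≤s (s≤s (s≤s ())))) _ _

typeA-factor : ∀ {T r} → (3 + T * 4) ∣ r → ¬ (3 ∣ r) → Σ ℕ λ p → TypeA p × p ∣ (3 + T * 4)
typeA-factor {T} {r} n∣r 3∤r = extract
  (product-residue-3 factors (trans (cong (_% 4) (sym isFactorisation)) ([m+kn]%n≡m%n 3 T 4)) factorsPrime)
  where
  open PrimeFactorisation (factorise (3 + T * 4))
  extract : (Σ ℕ λ p → Prime p × p % 4 ≡ 3 × p ∣ product factors) → Σ ℕ λ p → TypeA p × p ∣ (3 + T * 4)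
  extract (p , p-prime , p≡3 , p∣Π) = p , (p-prime , ≤∧≢⇒< 3≤p 3≢p , p≡3) , p∣n
    where
    p∣n : p ∣ (3 + T * 4)
    p∣n = subst (p ∣_) (sym isFactorisation) p∣Π
    3≤p : 3 ≤ p
    3≤p = subst (_≤ p) p≡3 (m%n≤m p 4)
    3≢p : 3 ≢ p
    3≢p refl = 3∤r (∣-trans p∣n n∣r)

module Filter {P : ℕ → Set} (P? : Decidable P) where

  -- A general `f` is needed for the induction, because the tail of `applyUpTo f` is `applyUpTo` of
  -- a shifted function.
  head-filter-nothing : ∀ f n → head (filter P? (applyUpTo f n)) ≡ nothing → ∀ {i} → i < n → ¬ P (f i)
  head-filter-nothing f (suc n) eq {i} i<n with P? (f 0)
  head-filter-nothing f (suc n) ()  i<n | yes _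
  head-filter-nothing f (suc n) eq {zero}  _         | no ¬p = ¬p
  head-filter-nothing f (suc n) eq {suc i} (s≤s i<n) | no ¬p = head-filter-nothing (λ i → f (suc i)) n eq i<n

  head-filter-just : ∀ f n {x} → head (filter P? (applyUpTo f n)) ≡ just x →
                     Σ ℕ λ i → x ≡ f i × P (f i) × (∀ {j} → j < i → ¬ P (f j))
  head-filter-just f (suc n) eq with P? (f 0)
  ... | yes p = 0 , sym (just-injective eq) , p , λ ()
  ... | no ¬p with head-filter-just (λ i → f (suc i)) n eq
  ...   | i , eq′ , p , none = suc i , eq′ , p , λ { {zero} _ → ¬p ; {suc j} (s≤s j<i) → none j<i }

-- Lower bounds and the exact values.

module _ {c} (r≥3 : 3 ≤ 3 + c) where
  lower-3 : ∀ {b k} → 0 < b → OrientedColorable (directedCycle (3 + c) r≥3) b k → 3 * b ≤ k * 1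
  lower-3 {k = k} b>0 (f , col) = ≤-trans bound-3 (≤-reflexive (sym (*-identityʳ k)))
    where open CycleColoring r≥3 b>0 f col

  lower-cases : ∀ {b k} → 0 < b → OrientedColorable (directedCycle (3 + c) r≥3) b k →
                4 * b ≤ k ⊎ Σ ℕ λ T → (3 + T * 4) ∣ (3 + c) × (3 + T * 4) * b ≤ k * suc T
  lower-cases {b} {k} b>0 (f , col) with 4 * b ≤? k
  ... | yes le = inj₁ le
  ... | no nle = inj₂ (cyclic-bound (≰⇒> nle))
    where open CycleColoring r≥3 b>0 f col

-- Distance 3 is 1 backwards, so all four color sets are disjoint.
lower-C₄ : ∀ {b k} → 0 < b → OrientedColorable (directedCycle 4 (m≤m+n 3 1)) b k → 4 * b ≤ k * 1
lower-C₄ {k = k} b>0 (f , col) = ≤-trans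
  (independent-bound (0 ∷ 1 ∷ 2 ∷ 3 ∷ [])
    ((near₁ 0 ∷ near₂ 0 ∷ (λ p → near₁ 3 (wrap (~-sym p))) ∷ []) ∷ (near₁ 1 ∷ near₂ 1 ∷ []) ∷ (near₁ 2 ∷ []) ∷ [] ∷ []))
  (≤-reflexive (sym (*-identityʳ k)))
  where open CycleColoring {c = 1} (m≤m+n 3 1) b>0 f col

-- Distances 3 and 4 are 2 and 1 backwards, so all five color sets are disjoint.
lower-C₅ : ∀ {b k} → 0 < b → OrientedColorable (directedCycle 5 (m≤m+n 3 2)) b k → 5 * b ≤ k * 1
lower-C₅ {k = k} b>0 (f , col) = ≤-trans
  (independent-bound (0 ∷ 1 ∷ 2 ∷ 3 ∷ 4 ∷ [])
    ((near₁ 0 ∷ near₂ 0 ∷ (λ p → near₂ 3 (wrap (~-sym p))) ∷ (λ p → near₁ 4 (wrap (~-sym p))) ∷ []) ∷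
     (near₁ 1 ∷ near₂ 1 ∷ (λ p → near₂ 4 (wrap (~-sym p))) ∷ []) ∷
     (near₁ 2 ∷ near₂ 2 ∷ []) ∷ (near₁ 3 ∷ []) ∷ [] ∷ []))
  (≤-reflexive (sym (*-identityʳ k)))
  where open CycleColoring {c = 2} (m≤m+n 3 2) b>0 f col

-- n / (T + 1) with n = 4T + 3 is increasing in T, and below 4.
bound-weaken : ∀ {S T} b k → S ≤ T → (3 + T * 4) * b ≤ k * suc T → (3 + S * 4) * b ≤ k * suc S
bound-weaken {S} {T} b k S≤T le = *-cancelˡ-≤ (suc T) (+-cancelʳ-≤ (suc T * b) _ _ (begin
  suc T * ((3 + S * 4) * b) + suc T * b  ≡⟨ lemma₁ S T b ⟩
  suc S * ((3 + T * 4) * b) + suc S * b  ≤⟨ +-mono-≤ (*-monoʳ-≤ (suc S) le) (*-monoˡ-≤ b (s≤s S≤T)) ⟩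
  suc S * (k * suc T) + suc T * b        ≡⟨ cong (_+ suc T * b) (lemma₂ (suc S) (suc T) k) ⟩
  suc T * (k * suc S) + suc T * b        ∎))
  where
  open ≤-Reasoning
  lemma₁ : ∀ S T b → suc T * ((3 + S * 4) * b) + suc T * b ≡ suc S * ((3 + T * 4) * b) + suc S * b
  lemma₁ = solve-∀
  lemma₂ : ∀ s t k → s * (k * t) ≡ t * (k * s)
  lemma₂ = solve-∀

bound-from-4 : ∀ S b k → 4 * b ≤ k → (3 + S * 4) * b ≤ k * suc S
bound-from-4 S b k le = begin
  (3 + S * 4) * b  ≤⟨ *-monoˡ-≤ b (n≤1+n (3 + S * 4)) ⟩
  (4 + S * 4) * b  ≡⟨ lemma S b ⟩
  4 * b * suc S    ≤⟨ *-monoˡ-≤ (suc S) le ⟩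
  k * suc S        ∎
  where
  open ≤-Reasoning
  lemma : ∀ S b → (4 + S * 4) * b ≡ 4 * b * suc S
  lemma = solve-∀

-- Both sides equal 4 - 1 / (S + 1).
ratio-as-difference : ∀ S → + (3 + S * 4) / suc S ≡ + 4 / 1 - + 4 / suc (3 + S * 4)
ratio-as-difference S = trans (sym (p+q-q≡p a z)) (cong (_- z) sum≡4)
  where
  a = + (3 + S * 4) / suc S
  z = + 4 / suc (3 + S * 4)
  numerators : ∀ S → ((3 + S * 4) * (4 + S * 4) + 4 * suc S) * 1 ≡ 4 * (suc S * (4 + S * 4))
  numerators = solve-∀
  sum≡4 : a ℚ.+ z ≡ + 4 / 1
  sum≡4 = ℚ.toℚᵘ-injective (begin
    toℚᵘ (a ℚ.+ z)                                      ≈⟨ ℚ.toℚᵘ-homo-+ a z ⟩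
    toℚᵘ a ℚᵘ.+ toℚᵘ z                                  ≈⟨ ℚᵘ.+-cong (ℚ.toℚᵘ-fromℚᵘ (mkℚᵘ (+ (3 + S * 4)) S)) (ℚ.toℚᵘ-fromℚᵘ (mkℚᵘ (+ 4) (3 + S * 4))) ⟩
    mkℚᵘ (+ (3 + S * 4)) S ℚᵘ.+ mkℚᵘ (+ 4) (3 + S * 4)  ≈⟨ ℚᵘ.*≡* integers ⟩
    mkℚᵘ (+ 4) 0                                        ∎)
    where
    open import Relation.Binary.Reasoning.Setoid ℚᵘ.≃-setoid
    integers : (+ (3 + S * 4) ℤ.* + (4 + S * 4) ℤ.+ + 4 ℤ.* + suc S) ℤ.* + 1 ≡ + 4 ℤ.* + (suc S * (4 + S * 4))
    integers = trans (sym (trans (ℤ.pos-* ((3 + S * 4) * (4 + S * 4) + 4 * suc S) 1) (cong (ℤ._* + 1)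
        (trans (ℤ.pos-+ ((3 + S * 4) * (4 + S * 4)) (4 * suc S)) (cong₂ ℤ._+_ (ℤ.pos-* (3 + S * 4) (4 + S * 4)) (ℤ.pos-* 4 (suc S)))))))
      (trans (cong +_ (numerators S)) (ℤ.pos-* 4 (suc S * (4 + S * 4))))

module NotMultipleOf3 (c : ℕ) (r≥3 : 3 ≤ 3 + c) (5<r : 5 < 3 + c) (3∤r : ¬ (3 ∣ (3 + c))) where
  private
    r = 3 + c
    C = directedCycle r r≥3

  lower-by-factor : ∀ {b k} → 0 < b → OrientedColorable C b k →
    4 * b ≤ k ⊎ Σ ℕ λ T → Σ ℕ λ p → TypeA p × p ∣ r × p ≤ 3 + T * 4 × (3 + T * 4) * b ≤ k * suc T
  lower-by-factor b>0 col with lower-cases r≥3 b>0 col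
  ... | inj₁ le = inj₁ le
  ... | inj₂ (T , n∣r , le) with typeA-factor {T} n∣r 3∤r
  ...   | p , typeA , p∣n = inj₂ (T , p , typeA , ∣-trans p∣n n∣r , ∣⇒≤ p∣n , le)

  -- Abstracting `l` lets one case split evaluate `β r` and keep the equation about the least
  -- factor.
  fractional : (l : Maybe ℕ) → leastTypeAFactor r ≡ l →
    IsFractionalOrientedChromaticNumber C (+ 4 / 1 - maybe′ (λ p → + 4 / suc p) 0ℚ l)
  fractional nothing eq = fractional-number r≥3 1 4 (four-coloring r≥3 5<r) lower
    where
    open Filter (λ p → typeA? p ×-dec p ∣? r)
    lower : ∀ {b k} → 0 < b → OrientedColorable C b k → 4 * b ≤ k * 1
    lower {k = k} b>0 col with lower-by-factor b>0 col
    ... | inj₁ le = ≤-trans le (≤-reflexive (sym (*-identityʳ k)))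
    ... | inj₂ (_ , p , typeA , p∣r , _) =
      contradiction (typeA , p∣r) (head-filter-nothing (λ i → i) (suc r) eq (s≤s (∣⇒≤ p∣r)))
  fractional (just p) eq with Filter.head-filter-just (λ p → typeA? p ×-dec p ∣? r) (λ i → i) (suc r) eq
  ... | _ , refl , ((_ , _ , p≡3) , p∣r) , least = subst
      (IsFractionalOrientedChromaticNumber C)
      (trans (ratio-as-difference S) (cong (λ p → + 4 / 1 - + 4 / suc p) (sym p≡)))
      (fractional-number r≥3 (suc S) (3 + S * 4) (Rotational.coloring r≥3 S (subst (_∣ r) p≡ p∣r)) lower)
    where
    S = p div 4
    p≡ : p ≡ 3 + S * 4
    p≡ = trans (m≡m%n+[m/n]*n p 4) (cong (_+ S * 4) p≡3)
    lower : ∀ {b k} → 0 < b → OrientedColorable C b k → (3 + S * 4) * b ≤ k * suc S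
    lower {b} {k} b>0 col with lower-by-factor b>0 col
    ... | inj₁ le = bound-from-4 S b k le
    -- By minimality p ≤ p′ ≤ 4T + 3, hence S ≤ T, and the bound for T implies the one for S.
    ... | inj₂ (T , p′ , typeA , p′∣r , p′≤n , le) = bound-weaken b k S≤T le
      where
      p≤n : 3 + S * 4 ≤ 3 + T * 4
      p≤n = subst (_≤ 3 + T * 4) p≡ (≤-trans (≮⇒≥ (λ p′<p → least p′<p (typeA , p′∣r))) p′≤n)
      S≤T : S ≤ T
      S≤T = *-cancelʳ-≤ S T 4 (+-cancelˡ-≤ 3 _ _ p≤n)

theorem5 : (∀ r (r≥3 : 3 ≤ r) → r % 3 ≡ 0 →
    IsFractionalOrientedChromaticNumber (directedCycle r r≥3) (+ 3 / 1))
    × IsFractionalOrientedChromaticNumber (directedCycle 4 (m≤m+n 3 1)) (+ 4 / 1)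
    × IsFractionalOrientedChromaticNumber (directedCycle 5 (m≤m+n 3 2)) (+ 5 / 1)
    × (∀ r (r≥3 : 3 ≤ r) → 5 < r → r % 3 ≢ 0 →
    IsFractionalOrientedChromaticNumber (directedCycle r r≥3) (+ 4 / 1 - β r))
theorem5 =
    (λ { (suc (suc (suc c))) r≥3@(s≤s (s≤s (s≤s _))) r%3≡0 → fractional-number r≥3 1 3
           (Rotational.coloring r≥3 0 (m%n≡0⇒n∣m (3 + c) 3 r%3≡0)) (lower-3 r≥3) })
  , fractional-number (m≤m+n 3 1) 1 4 (identity-coloring (m≤m+n 3 1)) lower-C₄
  , fractional-number (m≤m+n 3 2) 1 5 (identity-coloring (m≤m+n 3 2)) lower-C₅
  , (λ { (suc (suc (suc c))) r≥3@(s≤s (s≤s (s≤s _))) 5<r r%3≢0 →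
           NotMultipleOf3.fractional c r≥3 5<r (λ 3∣r → r%3≢0 (n∣m⇒m%n≡0 (3 + c) 3 3∣r)) _ refl })
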